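{- Let $n \geq 1$ and $k \geq 0$ be integers. If $\mathcal{F}$ is a locally $k$-wide family of arcs of $\mathbf{Z}_n$, then $|\mathcal{F}| \leq 2kn - k + 1$.
   Context: $\mathbf{Z}_n = \{0,1,\dots,n-1\}$ denotes the integers modulo $n$ with the clockwise cyclic order, in which $i$ precedes $i+1 \bmod n$. An arc of $\mathbf{Z}_n$ is a set of cyclically consecutive elements, i.e. a set of the form $\{i, i+1, \dots, i+m-1\}$ (modulo $n$) with $0 \leq m \leq n$; in particular the empty set and the whole set $\mathbf{Z}_n$ count as arcs. A family $\mathcal{F}$ of subsets of a finite set $X$ is locally $k$-wide iff for every $x \in X$ every antichain (with respect to inclusion) of $\{U \in \mathcal{F} \mid x \in U\}$ has at most $k$ members. -}

module Defs where

open import Data.Fin using (Fin; toℕ)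
open import Data.Fin.Subset using (Subset; _∈_; _⊆_)
open import Data.List using (List; length)
open import Data.List.Membership.Propositional using () renaming (_∈_ to _∈ₗ_)
open import Data.List.Relation.Unary.All using (All)
open import Data.List.Relation.Unary.Unique.Propositional using (Unique)
open import Data.Nat using (ℕ; NonZero; _+_; _<_; _≤_)
open import Data.Nat.DivMod using (_mod_)
open import Data.Product using (∃-syntax; _×_)
open import Function.Bundles using (_⇔_)
open import Relation.Binary.PropositionalEquality using (_≡_)

-- ℤₙ is represented by Fin n, and a finite set of subsets of Fin n by a
-- duplicate-free list, whose length is then its cardinality.

IsFamily : ∀ {n} → List (Subset n) → Set
IsFamily F = Unique F

-- U = {i, i+1, …, i+m-1} modulo n; m = 0 gives ∅ and m = n gives all of ℤₙ.
IsArc : ∀ {n} .{{_ : NonZero n}} → Subset n → Set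
IsArc {n} U =
  ∃[ i ] ∃[ m ] m ≤ n ×
    (∀ (x : Fin n) → x ∈ U ⇔ (∃[ j ] j < m × x ≡ (toℕ {n} i + j) mod n))

IsAntichain : ∀ {n} → List (Subset n) → Set
IsAntichain A = ∀ {U V} → U ∈ₗ A → V ∈ₗ A → U ⊆ V → U ≡ V

LocallyWide : ∀ {n} → ℕ → List (Subset n) → Set
LocallyWide {n} k F =
  ∀ (x : Fin n) (A : List (Subset n)) → IsFamily A →
  All (λ U → U ∈ₗ F × x ∈ U) A → IsAntichain A → length A ≤ k

{-# OPTIONS --safe #-}
module Submission where

import Data.Bool as Bool
open import Data.Empty using (⊥-elim)
open import Data.Fin using (Fin; toℕ)
import Data.Fin.Properties as Fin
open import Data.Fin.Subset using (Subset; _⊆_; ⊤; ⊥) renaming (_∈_ to _∈ₛ_)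
open import Data.Fin.Subset.Properties using (⊆-antisym; ⊆⊤; ⊥⊆)
open import Data.List using (List; []; _∷_; _++_; length; map; filter; replicate; upTo)
import Data.List.Membership.DecPropositional as DecMembership
open import Data.List.Membership.Propositional using (_∈_; find; lose)
open import Data.List.Membership.Propositional.Properties
  using (∈-++⁺ˡ; ∈-++⁺ʳ; ∈-++⁻; ∈-filter⁺; ∈-filter⁻; ∈-map⁺; ∈-map⁻; ∈-upTo⁺; ∈-upTo⁻; ∈-∃++)
open import Data.List.Properties
  using (length-++; length-++-sucʳ; length-map; length-replicate; filter-all; filter-accept; filter-reject; filter-≐)
open import Data.List.Relation.Unary.All as All using (All; []; _∷_)
import Data.List.Relation.Unary.All.Properties as All
open import Data.List.Relation.Unary.AllPairs as AllPairs using (AllPairs; []; _∷_)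
import Data.List.Relation.Unary.AllPairs.Properties as AllPairs
open import Data.List.Relation.Unary.Any as Any using (Any; here; there)
import Data.List.Relation.Unary.Any.Properties as Any
open import Data.List.Relation.Unary.Unique.Propositional using (Unique)
open import Data.Nat using (ℕ; zero; suc; NonZero; _+_; _*_; _∸_; _⊔_; _≤_; _<_; _≤?_; _<?_; z≤n; s≤s; z<s; _/_; _%_)
open import Data.Nat.DivMod using (_mod_; m%n<n; m≡m%n+[m/n]*n; [m+n]%n≡m%n; m<n⇒m%n≡m; /-monoˡ-≤)
open import Data.Nat.ListAction using (sum)
open import Data.Nat.Properties
open import Data.Nat.Solver using (module +-*-Solver)
open import Data.Product using (_×_; _,_; proj₁; proj₂; ∃-syntax)
open import Data.Sum using (_⊎_; inj₁; inj₂; [_,_])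
open import Data.Vec using (tabulate)
open import Data.Vec.Properties using (lookup∘tabulate; lookup⇒[]=; []=⇒lookup; ≡-dec)
open import Defs
open import Algebra.Properties.CommutativeSemigroup +-commutativeSemigroup using (x∙yz≈y∙xz)
open import Function using (_∘_; id)
open import Function.Bundles using (module Equivalence)
open import Relation.Binary using (tri<; tri≈; tri>)
open import Relation.Binary.PropositionalEquality
  using (_≡_; refl; sym; trans; cong; cong₂; subst; module ≡-Reasoning)
open import Relation.Unary using (_≐_)
open import Relation.Nullary using (Dec; ¬_; yes; no; contradiction; does)
open import Relation.Nullary.Decidable using (dec-true)

-- The arcs other than ∅ and ℤₙ are lifted to pairs i ≤ v < i + w of naturals
-- (first and last element), w = n − 1; an antichain through x is then a
-- sequence of pairs increasing in both coordinates with all i ≤ x ≤ all v.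
-- Sweep x upwards and keep k sets E₁, …, Eₖ of last elements, such that every
-- element of a later set exceeds some element of each earlier one and any
-- increasing choice of elements from different sets, in the order of the sets,
-- comes from such a sequence. The only operation straightens two neighbouring
-- sets E, F with m = min E: the elements of F below m move to E, m is dropped
-- from F. So at most one element is lost, and none if E is empty. Inserting the
-- arcs that start at x costs at most k elements (nothing remains to be put in
-- a (k+1)-st set, by k-wideness), and so does deleting x and straightening
-- again. This gives 2k per step, hence 2kn per period. To gain more than k per
-- period, consider max Eₜ + 1 − x, or 0 if Eₜ is empty: its sum over t does not
-- increase at a deletion, and at an insertion each term drops by at least 1,
-- except that for Eₜ empty it rises to at most w − 1 while level t loses
-- nothing. So on average there are at least k savings per w < n steps.

-- Levels and the straightening of neighbouring levels.

Levels : Set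
Levels = List (List ℕ)

Sorted : List ℕ → Set
Sorted = AllPairs _<_

-- An empty `E` dominates only the empty list, so in a `Normal` sequence every level after an empty
-- one is empty.
Dominated : List ℕ → List ℕ → Set
Dominated E F = All (λ f → Any (_< f) E) F

size : Levels → ℕ
size Es = sum (map length Es)

-- One more than the maximum; the value 0 at the empty list makes its `room` vanish.
top : List ℕ → ℕ
top []      = 0
top (v ∷ E) = suc v ⊔ top E

-- The number of naturals from x up to the maximum of E.
room : ℕ → List ℕ → ℕ
room x E = top E ∸ x

rooms : ℕ → Levels → ℕ
rooms x Es = sum (map (room x) Es)

-- The result of straightening (E , F) is (absorb E F , pass E F).
absorb pass : List ℕ → List ℕ → List ℕ
absorb []      F = F
absorb (m ∷ E) F = filter (_<? m) F ++ m ∷ E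
pass []      F = []
pass (m ∷ E) F = filter (m <?_) F

insert : Levels → List ℕ → Levels
insert []       N = []
insert (E ∷ Es) N = absorb E N ∷ insert Es (pass E N)

leftover : Levels → List ℕ → List ℕ
leftover []       N = N
leftover (E ∷ Es) N = leftover Es (pass E N)

compress : List ℕ → Levels → Levels
compress E []       = E ∷ []
compress E (F ∷ Fs) = absorb E F ∷ compress (pass E F) Fs

-- In normal levels without elements below `x`, only the first can contain `x`. Once `x` is removed
-- it may fail to dominate the others, which `compress` repairs.
delete : ℕ → Levels → Levels
delete x []       = []
delete x (E ∷ Es) = compress (filter (x <?_) E) Es

-- Elementary effects of straightening.

top⁺ : ∀ {E h} → All (_< h) E → top E ≤ h
top⁺ []       = z≤n
top⁺ (p ∷ ps) = ⊔-lub p (top⁺ ps)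

<top : ∀ E → All (_< top E) E
<top []      = []
<top (v ∷ E) = m≤m⊔n (suc v) (top E) ∷ All.map (λ p → ≤-trans p (m≤n⊔m (suc v) (top E))) (<top E)

top-mono : ∀ E F → (∀ {v} → v ∈ F → v ∈ E) → top F ≤ top E
top-mono E F F⊆E = top⁺ (All.tabulate (All.lookup (<top E) ∘ F⊆E))

absorb⁻ : ∀ E {F v} → v ∈ absorb E F → v ∈ E ⊎ v ∈ F
absorb⁻ []      p = inj₂ p
absorb⁻ (m ∷ E) {F} p with ∈-++⁻ (filter (_<? m) F) p
... | inj₁ q = inj₂ (proj₁ (∈-filter⁻ (_<? m) q))
... | inj₂ q = inj₁ q

pass⁻ : ∀ E {F v} → v ∈ pass E F → v ∈ F
pass⁻ (m ∷ E) p = proj₁ (∈-filter⁻ (m <?_) p)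

All-absorb : ∀ {P : ℕ → Set} E {F} → All P E → All P F → All P (absorb E F)
All-absorb E pE pF = All.tabulate λ p → [ All.lookup pE , All.lookup pF ] (absorb⁻ E p)

All-pass : ∀ {P : ℕ → Set} E {F} → All P F → All P (pass E F)
All-pass E pF = All.tabulate (All.lookup pF ∘ pass⁻ E)

-- As a set nothing is lost: the only element dropped from `F` is the head `m` of `E`, and `m`
-- itself stays in `absorb`.
absorb-⊇ : ∀ E {F f} → f ∈ F → f ∈ absorb E F ⊎ f ∈ pass E F
absorb-⊇ [] p = inj₁ p
absorb-⊇ (m ∷ E) {F} {f} p with <-cmp f m
... | tri< f<m _ _ = inj₁ (∈-++⁺ˡ (∈-filter⁺ (_<? m) p f<m))
... | tri≈ _ refl _ = inj₁ (∈-++⁺ʳ (filter (_<? m) F) (here refl))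
... | tri> _ _ m<f = inj₂ (∈-filter⁺ (m <?_) p m<f)

pass-dominated : ∀ E {F} → Dominated E (pass E F)
pass-dominated []      = []
pass-dominated (m ∷ E) {F} = All.map here (All.all-filter (m <?_) F)

absorb-dominates : ∀ E {F G} → Dominated E G → Dominated (absorb E F) G
absorb-dominates []      {F} d = All.map (λ ()) d
absorb-dominates (m ∷ E) {F} d = All.map (Any.++⁺ʳ (filter (_<? m) F)) d

absorb-sorted : ∀ E {F} → Sorted E → Sorted F → Sorted (absorb E F)
absorb-sorted []      sE sF = sF
absorb-sorted (m ∷ E) {F} (m< ∷ sE) sF =
  AllPairs.++⁺ (AllPairs.filter⁺ (_<? m) sF) (m< ∷ sE)
    (All.map (λ v<m → v<m ∷ All.map (<-trans v<m) m<) (All.all-filter (_<? m) F))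

pass-sorted : ∀ E {F} → Sorted F → Sorted (pass E F)
pass-sorted []      sF = []
pass-sorted (m ∷ E) sF = AllPairs.filter⁺ (m <?_) sF

-- Losses of elements and changes of room.

-- A strictly increasing `F` contains `m` at most once.
length-split : ∀ m {F} → Sorted F →
  length F ≤ length (filter (_<? m) F) + length (filter (m <?_) F) + 1
length-split m [] = z≤n
length-split m {f ∷ F} (f< ∷ s) with <-cmp f m
... | tri< f<m _ f≯m
  rewrite filter-accept (_<? m) {xs = F} f<m | filter-reject (m <?_) {xs = F} f≯m
  = s≤s (length-split m s)
... | tri≈ f≮m refl _
  rewrite filter-reject (f <?_) {xs = F} f≮m | filter-all (f <?_) f<
  = ≤-trans (≤-reflexive (+-comm 1 (length F))) (+-monoˡ-≤ 1 (m≤n+m (length F) _))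
... | tri> f≮m _ m<f
  rewrite filter-reject (_<? m) {xs = F} f≮m | filter-accept (m <?_) {xs = F} m<f
        | +-suc (length (filter (_<? m) F)) (length (filter (m <?_) F))
  = s≤s (length-split m s)

length-absorb-pass : ∀ E {F} → Sorted F →
  length E + length F ≤ suc (length (absorb E F) + length (pass E F))
length-absorb-pass []      {F} s = m≤n⇒m≤1+n (m≤m+n (length F) 0)
length-absorb-pass (m ∷ E) {F} s = begin
  suc (length E) + length F         ≤⟨ +-monoʳ-≤ (suc (length E)) (length-split m s) ⟩
  suc (length E) + (a + b + 1)
    ≡⟨ solve 3 (λ e a b → (con 1 :+ e) :+ (a :+ b :+ con 1) := con 1 :+ ((a :+ (con 1 :+ e)) :+ b))
         refl (length E) a b ⟩
  suc (a + suc (length E) + b)      ≡⟨ cong (λ c → suc (c + b)) (length-++ (filter (_<? m) F)) ⟨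
  suc (length (absorb (m ∷ E) F) + b) ∎
  where
  open ≤-Reasoning
  open +-*-Solver
  a = length (filter (_<? m) F)
  b = length (filter (m <?_) F)

-- Only elements below `m` are absorbed. An empty `E`, in contrast, takes all of `F`.
absorb-top : ∀ m E F → Sorted (m ∷ E) → top (absorb (m ∷ E) F) ≤ top (m ∷ E)
absorb-top m E F (m< ∷ s) = top⁺ (All.++⁺
  (All.map (λ v<m → <-trans v<m (m≤m⊔n (suc m) (top E))) (All.all-filter (_<? m) F))
  (<top (m ∷ E)))

size-compress : ∀ E {Fs} → All Sorted Fs →
  size (E ∷ Fs) ≤ size (compress E Fs) + length Fs
size-compress E {[]}     []       = m≤m+n _ 0
size-compress E {F ∷ Fs} (s ∷ ss) = begin
  e + (f + fs)                 ≡⟨ +-assoc e f fs ⟨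
  e + f + fs                   ≤⟨ +-monoˡ-≤ fs (length-absorb-pass E s) ⟩
  suc (a + b) + fs             ≡⟨ solve 3 (λ a b c → (con 1 :+ (a :+ b)) :+ c := con 1 :+ (a :+ (b :+ c))) refl a b fs ⟩
  suc (a + (b + fs))           ≤⟨ s≤s (+-monoʳ-≤ a (size-compress (pass E F) ss)) ⟩
  suc (a + (z + length Fs))    ≡⟨ solve 3 (λ a b c → con 1 :+ (a :+ (b :+ c)) := (a :+ b) :+ (con 1 :+ c)) refl a z (length Fs) ⟩
  a + z + suc (length Fs)      ∎
  where
  open ≤-Reasoning
  open +-*-Solver
  e = length E
  f = length F
  fs = size Fs
  a = length (absorb E F)
  b = length (pass E F)
  z = size (compress (pass E F) Fs)

-- A nonempty first level gets no larger maximum and `pass` is part of `F`; an empty first level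
-- takes over `F` together with its room.
rooms-compress : ∀ x E {Fs} → Sorted E → All Sorted Fs →
  rooms x (compress E Fs) ≤ rooms x (E ∷ Fs)
rooms-compress x E {[]}     s _ = ≤-refl
rooms-compress x [] {F ∷ Fs} s (sF ∷ ss) = begin
  room x F + rooms x (compress [] Fs) ≤⟨ +-monoʳ-≤ (room x F) (rooms-compress x [] [] ss) ⟩
  room x F + (room x [] + rooms x Fs) ≡⟨ cong (λ z → room x F + (z + rooms x Fs)) (0∸n≡0 x) ⟩
  room x F + rooms x Fs               ≤⟨ m≤n+m _ (room x []) ⟩
  room x [] + (room x F + rooms x Fs) ∎
  where open ≤-Reasoning
rooms-compress x (m ∷ E) {F ∷ Fs} s (sF ∷ ss) =
  +-mono-≤ (∸-monoˡ-≤ x (absorb-top m E F s))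
    (≤-trans (rooms-compress x (pass (m ∷ E) F) (pass-sorted (m ∷ E) sF) ss)
      (+-monoˡ-≤ (rooms x Fs) (∸-monoˡ-≤ x (top-mono F (pass (m ∷ E) F) (pass⁻ (m ∷ E))))))

filter-min : ∀ x {E} → Sorted E → All (x ≤_) E → length E ≤ suc (length (filter (x <?_) E))
filter-min x [] _ = z≤n
filter-min x {v ∷ E} (v< ∷ _) (x≤v ∷ _) with m≤n⇒m<n∨m≡n x≤v
... | inj₁ x<v rewrite filter-all (x <?_) (x<v ∷ All.map (<-trans x<v) v<) = n≤1+n _
... | inj₂ refl rewrite filter-reject (x <?_) {xs = E} (<-irrefl refl) | filter-all (x <?_) v< = ≤-refl

-- One element is lost by removing `x` and at most one for each neighbouring pair of levels, of
-- which there is one fewer than levels.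
size-delete : ∀ x {Es} → All Sorted Es → All (All (x ≤_)) Es →
  size Es ≤ size (delete x Es) + length Es
size-delete x {[]}     _        _        = z≤n
size-delete x {E ∷ Es} (s ∷ ss) (l ∷ ls) = begin
  length E + size Es                                          ≤⟨ +-monoˡ-≤ (size Es) (filter-min x s l) ⟩
  suc (length (filter (x <?_) E) + size Es)                   ≤⟨ s≤s (size-compress (filter (x <?_) E) ss) ⟩
  suc (size (delete x (E ∷ Es)) + length Es)                  ≡⟨ +-suc _ (length Es) ⟨
  size (delete x (E ∷ Es)) + length (E ∷ Es)                  ∎
  where open ≤-Reasoning

rooms-delete : ∀ x y {Es} → All Sorted Es → rooms y (delete x Es) ≤ rooms y Es
rooms-delete x y {[]}     _        = z≤n
rooms-delete x y {E ∷ Es} (s ∷ ss) =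
  ≤-trans (rooms-compress y (filter (x <?_) E) (AllPairs.filter⁺ (x <?_) s) ss)
    (+-monoˡ-≤ (rooms y Es) (∸-monoˡ-≤ y (top-mono E (filter (x <?_) E) (proj₁ ∘ ∈-filter⁻ (x <?_)))))

-- If E is empty nothing is lost, which pays for the room w newly occupied;
-- otherwise the room shrinks by 1 because x advances.
absorb-cost : ∀ {w x} E {N} → 0 < w → Sorted E → Sorted N → All (x ≤_) E → All (_< x + w) N →
  w * (length E + length N) + room (suc x) (absorb E N) + 1 ≤
  w * (length (absorb E N) + length (pass E N)) + w + room x E
absorb-cost {w} {x} [] {N} 0<w _ _ _ N< = begin
  w * length N + r + 1               ≡⟨ +-assoc (w * length N) r 1 ⟩
  w * length N + (r + 1)             ≤⟨ +-monoʳ-≤ (w * length N) r+1≤w ⟩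
  w * length N + w                   ≡⟨ cong (λ l → w * l + w) (+-identityʳ (length N)) ⟨
  w * (length N + 0) + w             ≤⟨ m≤m+n _ (room x []) ⟩
  w * (length N + 0) + w + room x [] ∎
  where
  open ≤-Reasoning
  r = room (suc x) N
  r+1≤w : r + 1 ≤ w
  r+1≤w = begin
    top N ∸ suc x + 1      ≤⟨ +-monoˡ-≤ 1 (∸-monoˡ-≤ (suc x) (top⁺ N<)) ⟩
    (x + w) ∸ suc x + 1    ≡⟨ cong (λ y → x + w ∸ y + 1) (+-comm 1 x) ⟩
    (x + w) ∸ (x + 1) + 1  ≡⟨ cong (_+ 1) ([m+n]∸[m+o]≡n∸o x w 1) ⟩
    w ∸ 1 + 1              ≡⟨ m∸n+n≡m 0<w ⟩
    w                      ∎
absorb-cost {w} {x} (m ∷ E) {N} 0<w sE sN (x≤m ∷ _) _ = begin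
  w * (e + length N) + r + 1     ≤⟨ +-monoˡ-≤ 1 (+-monoˡ-≤ r (*-monoʳ-≤ w (length-absorb-pass (m ∷ E) sN))) ⟩
  w * suc ab + r + 1             ≡⟨ +-assoc (w * suc ab) r 1 ⟩
  w * suc ab + (r + 1)           ≡⟨ cong (_+ (r + 1)) (trans (*-suc w ab) (+-comm w (w * ab))) ⟩
  w * ab + w + (r + 1)           ≤⟨ +-monoʳ-≤ (w * ab + w) r+1≤ ⟩
  w * ab + w + room x (m ∷ E)    ∎
  where
  open ≤-Reasoning
  e = length (m ∷ E)
  ab = length (absorb (m ∷ E) N) + length (pass (m ∷ E) N)
  r = room (suc x) (absorb (m ∷ E) N)
  r+1≤ : r + 1 ≤ room x (m ∷ E)
  r+1≤ = begin
    r + 1                         ≤⟨ +-monoˡ-≤ 1 (∸-monoˡ-≤ (suc x) (absorb-top m E N sE)) ⟩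
    top (m ∷ E) ∸ suc x + 1       ≡⟨ +-comm _ 1 ⟩
    suc (top (m ∷ E) ∸ suc x)     ≡⟨ +-∸-assoc 1 (≤-trans (s≤s x≤m) (m≤m⊔n (suc m) (top E))) ⟨
    top (m ∷ E) ∸ x               ∎

insert-cost : ∀ {w x} Es {N} → 0 < w → All Sorted Es → Sorted N →
  All (All (x ≤_)) Es → All (_< x + w) N →
  w * (size Es + length N) + rooms (suc x) (insert Es N) + length Es ≤
  w * (size (insert Es N) + length (leftover Es N)) + w * length Es + rooms x Es
insert-cost {w} []   {N} _ _ _ _ _ = +-monoˡ-≤ 0 (+-monoʳ-≤ (w * length N) z≤n)
-- The `b` elements passed by `E` are those to be inserted into `Es`; adding `w * b` to both sides
-- lets them cancel.
insert-cost {w} {x} (E ∷ Es) {N} 0<w (s ∷ ss) sN (l ∷ ls) N< = +-cancelʳ-≤ (w * b) _ _ (begin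
  w * ((e + es) + n) + (r + rs) + suc k + w * b
    ≡⟨ solve 8 (λ w e es n r rs k b → w :* ((e :+ es) :+ n) :+ (r :+ rs) :+ (con 1 :+ k) :+ w :* b
        := (w :* (e :+ n) :+ r :+ con 1) :+ (w :* (es :+ b) :+ rs :+ k)) refl w e es n r rs k b ⟩
  (w * (e + n) + r + 1) + (w * (es + b) + rs + k)
    ≤⟨ +-mono-≤ (absorb-cost E 0<w s sN l N<)
         (insert-cost Es 0<w ss (pass-sorted E sN) ls (All-pass E N<)) ⟩
  (w * (a + b) + w + q) + (w * (z + o) + w * k + qs)
    ≡⟨ solve 8 (λ w a b q z o k qs → (w :* (a :+ b) :+ w :+ q) :+ (w :* (z :+ o) :+ w :* k :+ qs)
        := w :* ((a :+ z) :+ o) :+ w :* (con 1 :+ k) :+ (q :+ qs) :+ w :* b) refl w a b q z o k qs ⟩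
  w * ((a + z) + o) + w * suc k + (q + qs) + w * b ∎)
  where
  open ≤-Reasoning
  open +-*-Solver
  e = length E
  es = size Es
  n = length N
  k = length Es
  a = length (absorb E N)
  b = length (pass E N)
  r = room (suc x) (absorb E N)
  rs = rooms (suc x) (insert Es (pass E N))
  q = room x E
  qs = rooms x Es
  z = size (insert Es (pass E N))
  o = length (leftover Es (pass E N))

-- Invariants of insertion and deletion.

AllOf : (ℕ → Set) → Levels → Set
AllOf P = All (All P)

Normal : Levels → Set
Normal = AllPairs Dominated

insert-all : ∀ {P} Es {N} → AllOf P Es → All P N → AllOf P (insert Es N)
insert-all []       _        _  = []
insert-all (E ∷ Es) (p ∷ ps) pN = All-absorb E p pN ∷ insert-all Es ps (All-pass E pN)

compress-all : ∀ {P} E {Fs} → All P E → AllOf P Fs → AllOf P (compress E Fs)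
compress-all E {[]}     p _        = p ∷ []
compress-all E {F ∷ Fs} p (q ∷ qs) = All-absorb E p q ∷ compress-all (pass E F) (All-pass E q) qs

delete-all : ∀ {P} x {Es} → AllOf P Es → AllOf P (delete x Es)
delete-all x []       = []
delete-all x (p ∷ ps) = compress-all _ (All.filter⁺ (x <?_) p) ps

insert-sorted : ∀ Es {N} → All Sorted Es → Sorted N → All Sorted (insert Es N)
insert-sorted []       _        _  = []
insert-sorted (E ∷ Es) (s ∷ ss) sN = absorb-sorted E s sN ∷ insert-sorted Es ss (pass-sorted E sN)

compress-sorted : ∀ E {Fs} → Sorted E → All Sorted Fs → All Sorted (compress E Fs)
compress-sorted E {[]}     s _        = s ∷ []
compress-sorted E {F ∷ Fs} s (t ∷ ts) = absorb-sorted E s t ∷ compress-sorted (pass E F) (pass-sorted E t) ts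

delete-sorted : ∀ x {Es} → All Sorted Es → All Sorted (delete x Es)
delete-sorted x []       = []
delete-sorted x (s ∷ ss) = compress-sorted _ (AllPairs.filter⁺ (x <?_) s) ss

length-insert : ∀ Es {N} → length (insert Es N) ≡ length Es
length-insert []       = refl
length-insert (E ∷ Es) = cong suc (length-insert Es)

length-compress : ∀ E Fs → length (compress E Fs) ≡ suc (length Fs)
length-compress E []       = refl
length-compress E (F ∷ Fs) = cong suc (length-compress (pass E F) Fs)

length-delete : ∀ x Es → length (delete x Es) ≡ length Es
length-delete x []       = refl
length-delete x (E ∷ Es) = length-compress _ Es

insert-normal : ∀ Es {N} → Normal Es → Normal (insert Es N)
insert-normal []       _        = []
insert-normal (E ∷ Es) (d ∷ ds) =
  insert-all Es (All.map (absorb-dominates E) d) (absorb-dominates E (pass-dominated E)) ∷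
  insert-normal Es ds

-- An element of `F` below `g` is either absorbed, or passed and then above an element of
-- `absorb E F`. So `absorb E F` dominates whatever `F` did.
compress-normal : ∀ E {Fs} → Normal Fs → Normal (compress E Fs)
compress-normal E {[]}     _        = [] ∷ []
compress-normal E {F ∷ Fs} (d ∷ ds) =
  compress-all (pass E F) pass-dom (All.map (All.map dom) d) ∷ compress-normal (pass E F) ds
  where
  pass-dom : Dominated (absorb E F) (pass E F)
  pass-dom = absorb-dominates E (pass-dominated E)
  dom : ∀ {g} → Any (_< g) F → Any (_< g) (absorb E F)
  dom {g} q with find q
  ... | f , f∈F , f<g with absorb-⊇ E f∈F
  ...   | inj₁ f∈A = lose f∈A f<g
  ...   | inj₂ f∈B = Any.map (λ a<f → <-trans a<f f<g) (All.lookup pass-dom f∈B)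

delete-normal : ∀ x {Es} → Normal Es → Normal (delete x Es)
delete-normal x []       = []
delete-normal x (_ ∷ ds) = compress-normal _ ds

dominated-> : ∀ {x E F} → All (x ≤_) E → Dominated E F → All (x <_) F
dominated-> {x} {E} l = All.map λ q → let e , e∈E , e<f = find q in ≤-<-trans (All.lookup l e∈E) e<f

delete-> : ∀ x {Es} → AllOf (x ≤_) Es → Normal Es → AllOf (x <_) (delete x Es)
delete-> x []           []       = []
delete-> x {E ∷ _} (l ∷ ls) (d ∷ _) =
  compress-all _ (All.all-filter (x <?_) E) (All.map (dominated-> l) d)

-- Increasing choices from the levels.

-- Pick Es lo hi r: an increasing sequence of r elements of [lo , hi), taken
-- from r different levels in the order of the levels.
data Pick : Levels → ℕ → ℕ → ℕ → Set where
  done : ∀ {lo hi} → Pick [] lo hi 0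
  skip : ∀ {E Es lo hi r} → Pick Es lo hi r → Pick (E ∷ Es) lo hi r
  take : ∀ {E Es lo hi r v} → v ∈ E → lo ≤ v → v < hi →
         Pick Es (suc v) hi r → Pick (E ∷ Es) lo hi (suc r)

pick-head : ∀ {E F Es lo hi r} → (∀ {v} → v ∈ E → v ∈ F) → Pick (E ∷ Es) lo hi r → Pick (F ∷ Es) lo hi r
pick-head sub (skip p)       = skip p
pick-head sub (take v∈ l h p) = take (sub v∈) l h p

pick-tail : ∀ {E Es Fs lo hi r} → (∀ {lo r} → Pick Es lo hi r → Pick Fs lo hi r) →
  Pick (E ∷ Es) lo hi r → Pick (E ∷ Fs) lo hi r
pick-tail sub (skip p)        = skip (sub p)
pick-tail sub (take v∈ l h p) = take v∈ l h (sub p)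

pick-last : ∀ Es {M N lo hi r} → (∀ {v} → v ∈ M → v ∈ N) →
  Pick (Es ++ M ∷ []) lo hi r → Pick (Es ++ N ∷ []) lo hi r
pick-last []       sub = pick-head sub
pick-last (E ∷ Es) sub = pick-tail (pick-last Es sub)

pick-one : ∀ Es {N lo hi v} → v ∈ N → lo ≤ v → v < hi → Pick (Es ++ N ∷ []) lo hi 1
pick-one []       v∈N l h = take v∈N l h done
pick-one (E ∷ Es) v∈N l h = skip (pick-one Es v∈N l h)

-- The first chosen element already exceeds `m`, so `m` can be put in front. With no element chosen,
-- nothing would force `m < hi`.
pick-raise : ∀ {Es m lo hi r} → AllOf (m <_) Es → Pick Es lo hi r →
  r ≡ 0 ⊎ m < hi × Pick Es (suc m) hi r
pick-raise _        done = inj₁ refl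
pick-raise (_ ∷ ps) (skip p) with pick-raise ps p
... | inj₁ r≡0        = inj₁ r≡0
... | inj₂ (m<hi , q) = inj₂ (m<hi , skip q)
pick-raise (p ∷ _) (take v∈E _ v<hi q) =
  inj₂ (<-trans (All.lookup p v∈E) v<hi , take v∈E (All.lookup p v∈E) v<hi q)

-- An absorbed element followed by a passed one is replaced by the minimum
-- of E, which is larger than the former and smaller than the latter.
pick-switch : ∀ E {F Fs lo hi r} → Pick (absorb E F ∷ pass E F ∷ Fs) lo hi r → Pick (E ∷ F ∷ Fs) lo hi r
pick-switch []      (skip (skip p))          = skip (skip p)
pick-switch []      (take v∈F l h (skip p))  = skip (take v∈F l h p)
pick-switch (m ∷ E) (skip p)                 = skip (pick-head (pass⁻ (m ∷ E)) p)
pick-switch (m ∷ E) {F} (take v∈A l h p) with ∈-++⁻ (filter (_<? m) F) v∈A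
... | inj₂ v∈E = take v∈E l h (pick-head (pass⁻ (m ∷ E)) p)
pick-switch (m ∷ E) {F} (take _ l h (skip p)) | inj₁ v∈ =
  skip (take (proj₁ (∈-filter⁻ (_<? m) v∈)) l h p)
pick-switch (m ∷ E) {F} (take _ l h (take u∈ v<u u<hi p)) | inj₁ v∈ =
  let _ , v<m = ∈-filter⁻ (_<? m) {xs = F} v∈
      u∈F , m<u = ∈-filter⁻ (m <?_) {xs = F} u∈
  in take (here refl) (≤-trans l (<⇒≤ v<m)) (<-trans m<u u<hi) (take u∈F m<u u<hi p)

pick-compress : ∀ E {Fs lo hi r} → Pick (compress E Fs) lo hi r → Pick (E ∷ Fs) lo hi r
pick-compress E {[]}     p = p
pick-compress E {F ∷ Fs} p = pick-switch E (pick-tail (pick-compress (pass E F)) p)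

pick-delete : ∀ x Es {lo hi r} → Pick (delete x Es) lo hi r → Pick Es lo hi r
pick-delete x []       p = p
pick-delete x (E ∷ Es) p = pick-head (proj₁ ∘ ∈-filter⁻ (x <?_)) (pick-compress _ p)

head-> : ∀ {m E F} → Sorted (m ∷ E) → Dominated (m ∷ E) F → All (m <_) F
head-> (m< ∷ _) = dominated-> (≤-refl ∷ All.map <⇒≤ m<)

-- In the target, `N` comes last and supplies at most the final element. An absorbed `v` from `N` is
-- replaced by the minimum `m` of its level if more choices follow, all of which exceed `m`;
-- otherwise it is itself the final element.
pick-insert : ∀ Es {N lo hi r} → All Sorted Es → Normal Es →
  Pick (insert Es N) lo hi r → Pick (Es ++ N ∷ []) lo hi r
pick-insert [] _ _ done = skip done
pick-insert (E ∷ Es) (_ ∷ ss) (_ ∷ ds) (skip p) =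
  skip (pick-last Es (pass⁻ E) (pick-insert Es ss ds p))
-- An empty level passes nothing and only empty levels follow it, so all later elements vacuously
-- exceed `hi` and no further choice is possible.
pick-insert ([] ∷ Es) {hi = hi} (_ ∷ ss) (d ∷ ds) (take v∈N l h p)
  with pick-raise {m = hi} (All.++⁺ (All.map (All.map λ ()) d) ([] ∷ [])) (pick-insert Es ss ds p)
... | inj₁ refl       = skip (pick-one Es v∈N l h)
... | inj₂ (hi<hi , _) = contradiction hi<hi (<-irrefl refl)
pick-insert ((m ∷ E) ∷ Es) {N} (s ∷ ss) (d ∷ ds) (take v∈A l h p)
  with ∈-++⁻ (filter (_<? m) N) v∈A | pick-insert Es ss ds p
... | inj₂ v∈E | q = take v∈E l h (pick-last Es (pass⁻ (m ∷ E)) q)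
... | inj₁ v∈  | q with ∈-filter⁻ (_<? m) {xs = N} v∈
                      | pick-raise (All.++⁺ (All.map (head-> s) d) (All.all-filter (m <?_) N ∷ [])) q
...   | v∈N , v<m | inj₁ refl = skip (pick-one Es v∈N l h)
...   | v∈N , v<m | inj₂ (m<hi , q′) =
  take (here refl) (≤-trans l (<⇒≤ v<m)) m<hi (pick-last Es (pass⁻ (m ∷ E) {N}) q′)

leftover⁻ : ∀ Es {N v} → v ∈ leftover Es N → v ∈ N
leftover⁻ []       p = p
leftover⁻ (E ∷ Es) p = pass⁻ E (leftover⁻ Es p)

-- By domination the minima of the levels increase, and an element passed by every level exceeds
-- them all: one choice more than there are levels.
pick-leftover : ∀ Es {N lo hi v} → All Sorted Es → Normal Es → AllOf (lo ≤_) Es → All (lo ≤_) N →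
  v ∈ leftover Es N → v < hi → Pick (Es ++ N ∷ []) lo hi (suc (length Es))
pick-leftover [] _ _ _ l v∈N v<hi = take v∈N (All.lookup l v∈N) v<hi done
pick-leftover ([] ∷ Es) _ _ _ _ v∈ _ = contradiction (leftover⁻ Es v∈) λ ()
pick-leftover ((m ∷ E) ∷ Es) {N} (s ∷ ss) (d ∷ ds) ((lo≤m ∷ _) ∷ _) l v∈ v<hi =
  take (here refl) lo≤m (<-trans m<v v<hi)
    (pick-last Es (pass⁻ (m ∷ E))
      (pick-leftover Es ss ds (All.map (head-> s) d) (All.all-filter (m <?_) N) v∈ v<hi))
  where m<v = All.lookup (All.all-filter (m <?_) N) (leftover⁻ Es v∈)

-- The choices before `v` are bounded by `v`, which is the form in which `snoc` extends a `Chain`.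
pick-snoc : ∀ Es {N lo hi r} → Pick (Es ++ N ∷ []) lo hi r →
  Pick Es lo hi r ⊎
  (∃[ v ] ∃[ s ] v ∈ N × lo ≤ v × v < hi × r ≡ suc s × Pick Es lo v s)
pick-snoc []       (skip done)          = inj₁ done
pick-snoc []       (take v∈ l h done)   = inj₂ (_ , _ , v∈ , l , h , refl , done)
pick-snoc (E ∷ Es) (skip p) with pick-snoc Es p
... | inj₁ q = inj₁ (skip q)
... | inj₂ (v , s , v∈ , l , h , eq , q) = inj₂ (v , s , v∈ , l , h , eq , skip q)
pick-snoc (E ∷ Es) (take u∈ lu hu p) with pick-snoc Es p
... | inj₁ q = inj₁ (take u∈ lu hu q)
... | inj₂ (v , s , v∈ , u<v , h , refl , q) =
  inj₂ (v , suc s , v∈ , ≤-trans lu (<⇒≤ u<v) , h , refl , take u∈ lu u<v q)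

-- Chains of lifted pairs.

-- Chain N x lo hi r: r pairs (i , v) with v ∈ N i, strictly increasing in
-- both coordinates, where i < x and lo ≤ v < hi.
data Chain (N : ℕ → List ℕ) : ℕ → ℕ → ℕ → ℕ → Set where
  []   : ∀ {x lo hi} → Chain N x lo hi 0
  snoc : ∀ {x lo hi r i v} → i < x → v ∈ N i → lo ≤ v → v < hi →
         Chain N i lo v r → Chain N x lo hi (suc r)

chain-mono : ∀ {N x y lo hi r} → x ≤ y → Chain N x lo hi r → Chain N y lo hi r
chain-mono x≤y []                   = []
chain-mono x≤y (snoc i<x v∈ l h c) = snoc (<-≤-trans i<x x≤y) v∈ l h c

-- Counting and the sweep.

-- The maximum with `a` covers an empty list with `b` below `a`.
sorted-length : ∀ {a b E} → Sorted E → All (a ≤_) E → All (_< b) E → a + length E ≤ a ⊔ b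
sorted-length {a} {b} [] _ _ = ≤-trans (≤-reflexive (+-identityʳ a)) (m≤m⊔n a b)
sorted-length {a} {b} {v ∷ E} (v< ∷ s) (a≤v ∷ _) (v<b ∷ b>) = begin
  a + suc (length E)   ≡⟨ +-suc a (length E) ⟩
  suc (a + length E)   ≤⟨ s≤s (+-monoˡ-≤ (length E) a≤v) ⟩
  suc v + length E     ≤⟨ sorted-length s v< b> ⟩
  suc v ⊔ b            ≡⟨ m≤n⇒m⊔n≡n v<b ⟩
  b                    ≤⟨ m≤n⊔m a b ⟩
  a ⊔ b                ∎
  where open ≤-Reasoning

count : (ℕ → List ℕ) → ℕ → ℕ
count N zero    = 0
count N (suc L) = length (N L) + count N L

-- `N x` holds the last elements of the pairs starting at `x`; `no-chain` expresses `k`-wideness at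
-- `x`.
module Sweep (w k : ℕ) (0<w : 0 < w) (N : ℕ → List ℕ)
  (sorted : ∀ x → Sorted (N x)) (N≥ : ∀ x → All (x ≤_) (N x)) (N< : ∀ x → All (_< x + w) (N x))
  (no-chain : ∀ {x hi} → ¬ Chain N (suc x) x hi (suc k)) where

  record State (x : ℕ) : Set where
    field
      levels  : Levels
      length≡ : length levels ≡ k
      ordered : All Sorted levels
      normal  : Normal levels
      ≥x      : AllOf (x ≤_) levels
      <x+w    : AllOf (_< x + w) levels
      lift    : ∀ {lo hi r} → Pick levels lo hi r → Chain N x lo hi r
      -- Divided by `w`, this bounds the losses so far by `2 * k` minus `k / w` per step, with
      -- `rooms` as a potential.
      cost    : w * count N x + k * x + rooms x levels ≤ w * size levels + 2 * k * w * x

  open State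

  initial : State 0
  initial = record
    { levels = replicate k [] ; length≡ = length-replicate k
    ; ordered = All.replicate⁺ k [] ; normal = empties k ; ≥x = All.replicate⁺ k [] ; <x+w = All.replicate⁺ k []
    ; lift = lift₀ k
    ; cost = ≤-trans (≤-reflexive (cost₀ k)) z≤n }
    where
    empties : ∀ k → Normal (replicate k [])
    empties zero    = []
    empties (suc k) = All.replicate⁺ k [] ∷ empties k
    lift₀ : ∀ k {lo hi r} → Pick (replicate k []) lo hi r → Chain N 0 lo hi r
    lift₀ zero    done     = []
    lift₀ (suc k) (skip p) = lift₀ k p
    rooms₀ : ∀ k → rooms 0 (replicate k []) ≡ 0
    rooms₀ zero    = refl
    rooms₀ (suc k) = rooms₀ k
    cost₀ : ∀ j → w * 0 + k * 0 + rooms 0 (replicate j []) ≡ 0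
    cost₀ j rewrite rooms₀ j | *-zeroʳ w | *-zeroʳ k = refl

  step : ∀ {x} → State x → State (suc x)
  step {x} S = record
    { levels  = delete x Is
    ; length≡ = trans (length-delete x Is) (trans (length-insert Es) (length≡ S))
    ; ordered = delete-sorted x Is-sorted
    ; normal  = delete-normal x Is-normal
    ; ≥x      = delete-> x Is≥ Is-normal
    ; <x+w    = delete-all x (insert-all Es (All.map (All.map m<n⇒m<1+n) (<x+w S)) (All.map m<n⇒m<1+n (N< x)))
    ; lift    = lift′ ∘ pick-insert Es (ordered S) (normal S) ∘ pick-delete x Is
    ; cost    = cost′ }
    where
    Es = levels S
    Is = insert Es (N x)
    Is-sorted = insert-sorted Es (ordered S) (sorted x)
    Is-normal = insert-normal Es {N x} (normal S)
    Is≥ = insert-all Es (≥x S) (N≥ x)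

    lift′ : ∀ {lo hi r} → Pick (Es ++ N x ∷ []) lo hi r → Chain N (suc x) lo hi r
    lift′ p with pick-snoc Es p
    ... | inj₁ q = chain-mono (n≤1+n x) (lift S q)
    -- The new pair starts at `x`, after every pair of the old chain.
    ... | inj₂ (v , s , v∈ , l , h , refl , q) = snoc ≤-refl v∈ l h (lift S q)

    -- A leftover element would yield a chain of `suc k` pairs with starts at most `x` and last
    -- elements at least `x`.
    nothing-left : leftover Es (N x) ≡ []
    nothing-left with leftover Es (N x) in eq
    ... | [] = refl
    ... | v ∷ _ = contradiction
      (lift′ (pick-leftover Es (ordered S) (normal S) (≥x S) (N≥ x) (subst (v ∈_) (sym eq) (here refl)) (n<1+n v)))
      (subst (λ j → ¬ Chain N (suc x) x (suc v) (suc j)) (sym (length≡ S)) no-chain)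

    insert-cost′ : w * (size Es + length (N x)) + rooms (suc x) Is + k ≤ w * size Is + w * k + rooms x Es
    insert-cost′ with insert-cost Es 0<w (ordered S) (sorted x) (≥x S) (N< x)
    ... | h rewrite nothing-left | +-identityʳ (size Is) | length≡ S = h

    size≤ : size Is ≤ size (delete x Is) + k
    size≤ with size-delete x Is-sorted Is≥
    ... | h rewrite trans (length-insert Es {N x}) (length≡ S) = h

    cost′ : w * count N (suc x) + k * suc x + rooms (suc x) (delete x Is) ≤
            w * size (delete x Is) + 2 * k * w * suc x
    cost′ = +-cancelʳ-≤ (w * e + q) _ _ (begin
      w * (n + c) + k * suc x + ρ′ + (w * e + q)
        ≤⟨ +-monoˡ-≤ (w * e + q) (+-monoʳ-≤ (w * (n + c) + k * suc x) (rooms-delete x (suc x) Is-sorted)) ⟩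
      w * (n + c) + k * suc x + ρ + (w * e + q)
        ≡⟨ solve 8 (λ w n c k x ρ e q → w :* (n :+ c) :+ k :* (con 1 :+ x) :+ ρ :+ (w :* e :+ q)
            := (w :* (e :+ n) :+ ρ :+ k) :+ (w :* c :+ k :* x :+ q)) refl w n c k x ρ e q ⟩
      (w * (e + n) + ρ + k) + (w * c + k * x + q)
        ≤⟨ +-mono-≤ insert-cost′ (cost S) ⟩
      (w * size Is + w * k + q) + (w * e + 2 * k * w * x)
        ≤⟨ +-monoˡ-≤ (w * e + 2 * k * w * x) (+-monoˡ-≤ q (+-monoˡ-≤ (w * k) (*-monoʳ-≤ w size≤))) ⟩
      (w * (d + k) + w * k + q) + (w * e + 2 * k * w * x)
        ≡⟨ solve 6 (λ w d k q e x → (w :* (d :+ k) :+ w :* k :+ q) :+ (w :* e :+ con 2 :* k :* w :* x)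
            := w :* d :+ con 2 :* k :* w :* (con 1 :+ x) :+ (w :* e :+ q)) refl w d k q e x ⟩
      w * d + 2 * k * w * suc x + (w * e + q) ∎)
      where
      open ≤-Reasoning
      open +-*-Solver
      n = length (N x)
      c = count N x
      e = size Es
      q = rooms x Es
      ρ = rooms (suc x) Is
      ρ′ = rooms (suc x) (delete x Is)
      d = size (delete x Is)

  state : ∀ x → State x
  state zero    = initial
  state (suc x) = step (state x)

  -- Each level is strictly increasing within a window of `w` numbers. The bound does not grow with
  -- `x`, so averaging removes it.
  size-bound : ∀ {x} Es → All Sorted Es → AllOf (x ≤_) Es → AllOf (_< x + w) Es → size Es ≤ length Es * w
  size-bound []       _        _        _        = z≤n
  size-bound {x} (E ∷ Es) (s ∷ ss) (l ∷ ls) (h ∷ hs) = +-mono-≤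
    (+-cancelˡ-≤ x _ _ (≤-trans (sorted-length s l h) (≤-reflexive (m≤n⇒m⊔n≡n (m≤m+n x w)))))
    (size-bound Es ss ls hs)

  count-bound : ∀ L → w * count N L + k * L ≤ w * (k * w) + 2 * k * w * L
  count-bound L = begin
    w * count N L + k * L                       ≤⟨ m≤m+n _ _ ⟩
    w * count N L + k * L + rooms L (levels S)  ≤⟨ cost S ⟩
    w * size (levels S) + 2 * k * w * L         ≤⟨ +-monoˡ-≤ _ (*-monoʳ-≤ w (size-bound _ (ordered S) (≥x S) (<x+w S))) ⟩
    w * (length (levels S) * w) + 2 * k * w * L ≡⟨ cong (λ j → w * (j * w) + 2 * k * w * L) (length≡ S) ⟩
    w * (k * w) + 2 * k * w * L                 ∎
    where
    open ≤-Reasoning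
    S = state L

-- Counts over several periods.

count-shift : ∀ {N n} → (∀ x → length (N (n + x)) ≡ length (N x)) → ∀ L → count N (n + L) ≡ count N n + count N L
count-shift {N} {n} per zero    = trans (cong (count N) (+-identityʳ n)) (sym (+-identityʳ (count N n)))
count-shift {N} {n} per (suc L) = begin
  count N (n + suc L)                            ≡⟨ cong (count N) (+-suc n L) ⟩
  length (N (n + L)) + count N (n + L)           ≡⟨ cong₂ _+_ (per L) (count-shift per L) ⟩
  length (N L) + (count N n + count N L)         ≡⟨ x∙yz≈y∙xz (length (N L)) (count N n) (count N L) ⟩
  count N n + (length (N L) + count N L)         ∎
  where open ≡-Reasoning

count-* : ∀ {N n} → (∀ x → length (N (n + x)) ≡ length (N x)) → ∀ M → count N (M * n) ≡ M * count N n
count-* per zero    = refl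
count-* {N} {n} per (suc M) = trans (count-shift per (M * n)) (cong (count N n +_) (count-* per M))

-- Duplicate-free lists and residues.

unique-⊆⇒length≤ : ∀ {A : Set} {xs ys : List A} → Unique xs → (∀ {x} → x ∈ xs → x ∈ ys) → length xs ≤ length ys
unique-⊆⇒length≤ [] _ = z≤n
unique-⊆⇒length≤ {xs = x ∷ xs} (x∉ ∷ u) sub with ∈-∃++ (sub (here refl))
... | ls , rs , refl = ≤-trans (s≤s (unique-⊆⇒length≤ u sub′)) (≤-reflexive (sym (length-++-sucʳ ls x rs)))
  where
  sub′ : ∀ {y} → y ∈ xs → y ∈ ls ++ rs
  sub′ y∈ with ∈-++⁻ ls (sub (there y∈))
  ... | inj₁ p           = ∈-++⁺ˡ p
  ... | inj₂ (here refl) = contradiction refl (All.lookup x∉ y∈)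
  ... | inj₂ (there p)   = ∈-++⁺ʳ ls p

toℕ-mod : ∀ a n .{{_ : NonZero n}} → toℕ (a mod n) ≡ a % n
toℕ-mod a n = Fin.toℕ-fromℕ< (m%n<n a n)

-- Equal remainders with different quotients would put `b` at least `n` above `a`.
mod-injective : ∀ {a b n} .{{_ : NonZero n}} → a ≤ b → b < a + n → a mod n ≡ b mod n → a ≡ b
mod-injective {a} {b} {n} a≤b b<a+n eq = by-quotient (m≤n⇒m<n∨m≡n (/-monoˡ-≤ n a≤b))
  where
  %≡ : a % n ≡ b % n
  %≡ = trans (sym (toℕ-mod a n)) (trans (cong toℕ eq) (toℕ-mod b n))
  by-quotient : a / n < b / n ⊎ a / n ≡ b / n → a ≡ b
  by-quotient (inj₂ /≡) = begin
    a                  ≡⟨ m≡m%n+[m/n]*n a n ⟩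
    a % n + a / n * n  ≡⟨ cong₂ (λ r q → r + q * n) %≡ /≡ ⟩
    b % n + b / n * n  ≡⟨ m≡m%n+[m/n]*n b n ⟨
    b                  ∎
    where open ≡-Reasoning
  by-quotient (inj₁ /<) = contradiction b<a+n (≤⇒≯ (begin
    a + n                      ≡⟨ cong (_+ n) (m≡m%n+[m/n]*n a n) ⟩
    a % n + a / n * n + n      ≡⟨ +-assoc (a % n) (a / n * n) n ⟩
    a % n + (a / n * n + n)    ≡⟨ cong₂ _+_ %≡ (+-comm (a / n * n) n) ⟩
    b % n + suc (a / n) * n    ≤⟨ +-monoʳ-≤ (b % n) (*-monoˡ-≤ n /<) ⟩
    b % n + b / n * n          ≡⟨ m≡m%n+[m/n]*n b n ⟨
    b                          ∎))
    where open ≤-Reasoning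

[n+m]mod≡ : ∀ m n .{{_ : NonZero n}} → (n + m) mod n ≡ m mod n
[n+m]mod≡ m n = Fin.toℕ-injective (begin
  toℕ ((n + m) mod n)  ≡⟨ toℕ-mod (n + m) n ⟩
  (n + m) % n          ≡⟨ cong (_% n) (+-comm n m) ⟩
  (m + n) % n          ≡⟨ [m+n]%n≡m%n m n ⟩
  m % n                ≡⟨ toℕ-mod m n ⟨
  toℕ (m mod n)        ∎)
  where open ≡-Reasoning

toℕ-mod-id : ∀ {n} .{{_ : NonZero n}} (y : Fin n) → toℕ y mod n ≡ y
toℕ-mod-id {n} y = Fin.toℕ-injective (trans (toℕ-mod (toℕ y) n) (m<n⇒m%n≡m (Fin.toℕ<n y)))

-- Arcs as intervals of lifted positions.

module Arcs (w : ℕ) where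

  n : ℕ
  n = suc w

  inArc? : ∀ a m (y : Fin n) → Dec (∃[ j ] j < m × y ≡ (a + j) mod n)
  inArc? a m y = anyUpTo? (λ j → y Fin.≟ (a + j) mod n) m

  -- The start may be any natural number, so that pairs from every period represent arcs.
  arc : ℕ → ℕ → Subset n
  arc a m = tabulate (does ∘ inArc? a m)

  ∈-arc⁺ : ∀ a m {y} → (∃[ j ] j < m × y ≡ (a + j) mod n) → y ∈ₛ arc a m
  ∈-arc⁺ a m {y} p = lookup⇒[]= y _ (trans (lookup∘tabulate (does ∘ inArc? a m) y) (dec-true (inArc? a m y) p))

  ∈-arc⁻ : ∀ a m {y} → y ∈ₛ arc a m → ∃[ j ] j < m × y ≡ (a + j) mod n
  ∈-arc⁻ a m {y} p with inArc? a m y | trans (sym (lookup∘tabulate (does ∘ inArc? a m) y)) ([]=⇒lookup p)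
  ... | yes q | _  = q
  ... | no _  | ()

  arc-shift : ∀ a m → arc (n + a) m ≡ arc a m
  arc-shift a m = ⊆-antisym (λ p → let j , j<m , eq = ∈-arc⁻ (n + a) m p in ∈-arc⁺ a m (j , j<m , trans eq (shift j)))
                            (λ p → let j , j<m , eq = ∈-arc⁻ a m p in ∈-arc⁺ (n + a) m (j , j<m , trans eq (sym (shift j))))
    where
    shift : ∀ j → (n + a + j) mod n ≡ (a + j) mod n
    shift j = trans (cong (_mod n) (+-assoc n a j)) ([n+m]mod≡ (a + j) n)

  isArc⇒arc : ∀ {U : Subset n} → IsArc U → ∃[ i ] ∃[ m ] m ≤ n × U ≡ arc (toℕ {n} i) m
  isArc⇒arc (i , m , m≤n , mem) = i , m , m≤n ,
    ⊆-antisym (λ {y} p → ∈-arc⁺ (toℕ i) m (Equivalence.to (mem y) p))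
             (λ {y} p → Equivalence.from (mem y) (∈-arc⁻ (toℕ i) m p))

  arc-full : ∀ (i : Fin n) → arc (toℕ i) n ≡ ⊤
  arc-full i = ⊆-antisym ⊆⊤ λ {y} _ → ∈-arc⁺ (toℕ i) n (offset y)
    where
    offset : ∀ y → ∃[ j ] j < n × y ≡ (toℕ i + j) mod n
    offset y with toℕ i ≤? toℕ y
    ... | yes i≤y = toℕ y ∸ toℕ i , ≤-<-trans (m∸n≤m (toℕ y) (toℕ i)) (Fin.toℕ<n y) ,
      sym (trans (cong (_mod n) (m+[n∸m]≡n i≤y)) (toℕ-mod-id y))
    ... | no i≰y = n + toℕ y ∸ toℕ i , +-cancelˡ-< (toℕ i) _ _ (begin-strict
        toℕ i + (n + toℕ y ∸ toℕ i)  ≡⟨ i+ ⟩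
        n + toℕ y                    <⟨ +-monoʳ-< n (≰⇒> i≰y) ⟩
        n + toℕ i                    ≡⟨ +-comm n (toℕ i) ⟩
        toℕ i + n                    ∎) ,
      sym (trans (cong (_mod n) i+) (trans ([n+m]mod≡ (toℕ y) n) (toℕ-mod-id y)))
      where
      open ≤-Reasoning
      i+ : toℕ i + (n + toℕ y ∸ toℕ i) ≡ n + toℕ y
      i+ = m+[n∸m]≡n (≤-trans (<⇒≤ (Fin.toℕ<n i)) (m≤m+n n (toℕ y)))

  interval : ℕ → ℕ → Subset n
  interval i v = arc i (suc (v ∸ i))

  ∈-interval⁺ : ∀ {i v y} → i ≤ y → y ≤ v → y mod n ∈ₛ interval i v
  ∈-interval⁺ {i} {v} i≤y y≤v =
    ∈-arc⁺ i (suc (v ∸ i)) (_ , s≤s (∸-monoˡ-≤ i y≤v) , cong (_mod n) (sym (m+[n∸m]≡n i≤y)))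

  ∈-interval⁻ : ∀ {i v y} → i ≤ v → y ∈ₛ interval i v → ∃[ z ] i ≤ z × z ≤ v × y ≡ z mod n
  ∈-interval⁻ {i} {v} i≤v p with ∈-arc⁻ i (suc (v ∸ i)) p
  ... | j , s≤s j≤ , eq = i + j , m≤m+n i j ,
    ≤-trans (+-monoʳ-≤ i j≤) (≤-reflexive (m+[n∸m]≡n i≤v)) , eq

  -- The interval has at most `n` - 1 elements, so the position just before it does not recur in it
  -- modulo `n`; the same holds for the position just after it.
  before∉interval : ∀ {p v} → suc p ≤ v → v < suc p + w → ¬ (p mod n ∈ₛ interval (suc p) v)
  before∉interval {p} {v} p<v v< m with ∈-interval⁻ p<v m
  ... | z , p<z , z≤v , eq = <⇒≢ p<z (mod-injective (<⇒≤ p<z) z<p+n eq)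
    where
    z<p+n : z < p + n
    z<p+n = ≤-<-trans z≤v (subst (v <_) (sym (+-suc p w)) v<)

  after∉interval : ∀ {i v} → i ≤ v → v < i + w → ¬ (suc v mod n ∈ₛ interval i v)
  after∉interval {i} {v} i≤v v< m with ∈-interval⁻ i≤v m
  ... | z , i≤z , z≤v , eq = <⇒≢ (s≤s z≤v) (mod-injective (m≤n⇒m≤1+n z≤v) sv<z+n (sym eq))
    where
    sv<z+n : suc v < z + n
    sv<z+n = subst (suc v <_) (sym (+-suc z w)) (s≤s (≤-trans v< (+-monoˡ-≤ w i≤z)))

  Incomparable : Subset n → Subset n → Set
  Incomparable U V = ¬ U ⊆ V × ¬ V ⊆ U

  -- The position after `v′` lies only in the first interval, the one before `i` only in the second.
  crossing⇒incomparable : ∀ {i v i′ v′} → i′ < i → v′ < v → i ≤ v′ → v′ < i′ + w → v < i + w →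
    Incomparable (interval i v) (interval i′ v′)
  crossing⇒incomparable {suc p} {v} {i′} {v′} (s≤s i′≤p) v′<v p<v′ v′< v< =
    (λ sub → after∉interval i′≤v′ v′< (sub (∈-interval⁺ (≤-trans p<v′ (n≤1+n v′)) v′<v))) ,
    (λ sub → before∉interval (≤-trans p<v′ (<⇒≤ v′<v)) v< (sub (∈-interval⁺ i′≤p (<⇒≤ p<v′))))
    where i′≤v′ = ≤-trans i′≤p (<⇒≤ p<v′)

  incomparable⇒unique : ∀ {A} → AllPairs Incomparable A → Unique A
  incomparable⇒unique = AllPairs.map λ { (U⊈V , _) refl → U⊈V id }

  incomparable⇒antichain : ∀ {A} → AllPairs Incomparable A → IsAntichain A
  incomparable⇒antichain (_ ∷ _)  (here refl) (here refl) _   = refl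
  incomparable⇒antichain (p ∷ _)  (here refl) (there V∈)  U⊆V = ⊥-elim (proj₁ (All.lookup p V∈) U⊆V)
  incomparable⇒antichain (p ∷ _)  (there U∈)  (here refl) U⊆V = ⊥-elim (proj₂ (All.lookup p U∈) U⊆V)
  incomparable⇒antichain (_ ∷ ps) (there U∈)  (there V∈)  U⊆V = incomparable⇒antichain ps U∈ V∈ U⊆V

  -- The lifted pairs of a family.

  module Family (F : List (Subset n)) where

    _∈F? : ∀ U → Dec (U ∈ F)
    U ∈F? = U ∈? F
      where open DecMembership (≡-dec Bool._≟_)

    -- The last elements of the arcs of F that start at x mod n and have
    -- between 1 and n − 1 elements, lifted to {x, …, x + n − 2}.
    ends : ℕ → List ℕ
    ends x = map (x +_) (filter (λ d → arc x (suc d) ∈F?) (upTo w))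

    ends⁻ : ∀ {x v} → v ∈ ends x → x ≤ v × v < x + w × interval x v ∈ F
    ends⁻ {x} v∈ with ∈-map⁻ (x +_) v∈
    ... | d , d∈ , refl with ∈-filter⁻ (λ d → arc x (suc d) ∈F?) {xs = upTo w} d∈
    ...   | d<w , U∈F = m≤m+n x d , +-monoʳ-< x (∈-upTo⁻ d<w) ,
      subst (λ e → arc x (suc e) ∈ F) (sym (m+n∸m≡n x d)) U∈F

    ends⁺ : ∀ {x d} → d < w → arc x (suc d) ∈ F → x + d ∈ ends x
    ends⁺ {x} d<w U∈F = ∈-map⁺ (x +_) (∈-filter⁺ (λ d → arc x (suc d) ∈F?) (∈-upTo⁺ d<w) U∈F)

    ends-sorted : ∀ x → Sorted (ends x)
    ends-sorted x = AllPairs.map⁺ (AllPairs.filter⁺ (λ d → arc x (suc d) ∈F?)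
      (AllPairs.applyUpTo⁺₁ id w λ i<j _ → +-monoʳ-< x i<j))

    ends-periodic : ∀ x → length (ends (n + x)) ≡ length (ends x)
    ends-periodic x = begin
      length (ends (n + x))               ≡⟨ length-map (n + x +_) (filter from-n+x? (upTo w)) ⟩
      length (filter from-n+x? (upTo w))  ≡⟨ cong length (filter-≐ from-n+x? from-x? same (upTo w)) ⟩
      length (filter from-x? (upTo w))    ≡⟨ length-map (x +_) (filter from-x? (upTo w)) ⟨
      length (ends x)                     ∎
      where
      open ≡-Reasoning
      from-n+x? = λ d → arc (n + x) (suc d) ∈F?
      from-x? = λ d → arc x (suc d) ∈F?
      same : (λ d → arc (n + x) (suc d) ∈ F) ≐ (λ d → arc x (suc d) ∈ F)
      same = (λ {d} → subst (_∈ F) (arc-shift x (suc d))) , (λ {d} → subst (_∈ F) (sym (arc-shift x (suc d))))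

    members : ∀ {x lo hi r} → Chain ends x lo hi r → List (Subset n)
    members []                               = []
    members (snoc {i = i} {v = v} _ _ _ _ c) = interval i v ∷ members c

    length-members : ∀ {x lo hi r} (c : Chain ends x lo hi r) → length (members c) ≡ r
    length-members []               = refl
    length-members (snoc _ _ _ _ c) = cong suc (length-members c)

    members-all : ∀ {P : Subset n → Set} {x lo hi r} →
      (∀ {i v} → i < x → v ∈ ends i → lo ≤ v → v < hi → P (interval i v)) →
      (c : Chain ends x lo hi r) → All P (members c)
    members-all p []                    = []
    members-all p (snoc i<x v∈ l h c) =
      p i<x v∈ l h ∷ members-all (λ j<i u∈ l′ u<v → p (<-trans j<i i<x) u∈ l′ (<-trans u<v h)) c

    -- By `x ≤ suc lo` every start is at most `lo`, hence at most every last element, so any two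
    -- members cross.
    members-incomparable : ∀ {x lo hi r} → x ≤ suc lo → (c : Chain ends x lo hi r) → AllPairs Incomparable (members c)
    members-incomparable x≤ []                   = []
    members-incomparable x≤ (snoc i<x v∈ l h c) =
      members-all (λ j<i u∈ lo≤u u<v → crossing⇒incomparable j<i u<v (≤-trans i≤lo lo≤u)
        (proj₁ (proj₂ (ends⁻ u∈))) (proj₁ (proj₂ (ends⁻ v∈)))) c ∷
      members-incomparable (m≤n⇒m≤1+n i≤lo) c
      where i≤lo = ≤-pred (≤-trans i<x x≤)

    wide⇒no-chain : ∀ {k x hi} → LocallyWide k F → ¬ Chain ends (suc x) x hi (suc k)
    wide⇒no-chain {k} {x} wide c = 1+n≰n (subst (_≤ k) (length-members c)
      (wide (x mod n) (members c) (incomparable⇒unique inc)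
        -- Starts at most `x` and last elements at least `x` put `x mod n` into every member.
        (members-all (λ i≤x v∈ x≤v _ → proj₂ (proj₂ (ends⁻ v∈)) , ∈-interval⁺ (≤-pred i≤x) x≤v) c)
        (incomparable⇒antichain inc)))
      where inc = members-incomparable ≤-refl c

    proper : ℕ → List (Subset n)
    proper zero    = []
    proper (suc L) = map (interval L) (ends L) ++ proper L

    length-proper : ∀ L → length (proper L) ≡ count ends L
    length-proper zero    = refl
    length-proper (suc L) = trans (length-++ (map (interval L) (ends L)))
      (cong₂ _+_ (length-map (interval L) (ends L)) (length-proper L))

    ∈-proper : ∀ {i v L} → i < L → v ∈ ends i → interval i v ∈ proper L
    ∈-proper {i} {v} {suc L} (s≤s i≤L) v∈ with m≤n⇒m<n∨m≡n i≤L
    ... | inj₁ i<L  = ∈-++⁺ʳ (map (interval L) (ends L)) (∈-proper i<L v∈)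
    ... | inj₂ refl = ∈-++⁺ˡ (∈-map⁺ (interval L) v∈)

    -- Length 0 gives the empty set from any start, length `n` gives `⊤`, and the lengths in between
    -- are those recorded by `ends`.
    arcs-classified : All IsArc F → ∀ {U} → U ∈ F → U ∈ arc 0 0 ∷ ⊤ ∷ proper n
    arcs-classified arcs U∈ with isArc⇒arc (All.lookup arcs U∈)
    ... | i , zero  , _       , refl = here (⊆-antisym (λ p → absurd (∈-arc⁻ (toℕ i) 0 p)) (λ p → absurd (∈-arc⁻ 0 0 p)))
      where
      absurd : ∀ {Q : ℕ → Set} {X : Set} → (∃[ j ] j < 0 × Q j) → X
      absurd (_ , () , _)
    ... | i , suc d , s≤s d≤w , refl with m≤n⇒m<n∨m≡n d≤w
    ...   | inj₂ refl = there (here (arc-full i))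
    ...   | inj₁ d<w  = there (there (subst (λ e → arc (toℕ i) (suc e) ∈ proper n) (m+n∸m≡n (toℕ i) d)
                          (∈-proper (Fin.toℕ<n i) (ends⁺ d<w U∈))))

    length≤count : IsFamily F → All IsArc F → length F ≤ 2 + count ends n
    length≤count u arcs = ≤-trans (unique-⊆⇒length≤ u (arcs-classified arcs))
      (≤-reflexive (cong (2 +_) (length-proper n)))

-- Averaging over many periods and the final bound.

-- With n = w + 1 the left side is w s M + k w M + k M, so the surplus k M
-- exceeds the constant k w² as soon as M > w².
average : ∀ {w k s} → 0 < k → (∀ M → w * (M * s) + k * (M * suc w) ≤ w * (k * w) + 2 * k * w * (M * suc w)) →
  s + k < 2 * k * suc w
average {w} {k@(suc _)} {s} _ bound with s + k <? 2 * k * suc w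
... | yes p = p
... | no ¬p = contradiction (*-cancelˡ-≤ k (+-cancelʳ-≤ rest (k * M) (k * (w * w)) kM≤)) 1+n≰n
  where
  open ≤-Reasoning
  open +-*-Solver
  M = suc (w * w)
  rest = w * (M * s) + (k * M * w + 2 * k * w * (M * suc w))
  kM≤ : k * M + rest ≤ k * (w * w) + rest
  kM≤ = begin
    k * M + rest
      ≡⟨ solve 4 (λ w k s M → k :* M :+ (w :* (M :* s) :+ (k :* M :* w :+ con 2 :* k :* w :* (M :* (con 1 :+ w))))
          := (w :* (M :* s) :+ k :* (M :* (con 1 :+ w))) :+ w :* (M :* (con 2 :* k :* (con 1 :+ w)))) refl w k s M ⟩
    (w * (M * s) + k * (M * suc w)) + w * (M * (2 * k * suc w))
      ≤⟨ +-mono-≤ (bound M) (*-monoʳ-≤ w (*-monoʳ-≤ M (≮⇒≥ ¬p))) ⟩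
    (w * (k * w) + 2 * k * w * (M * suc w)) + w * (M * (s + k))
      ≡⟨ solve 4 (λ w k s M → (w :* (k :* w) :+ con 2 :* k :* w :* (M :* (con 1 :+ w))) :+ w :* (M :* (s :+ k))
          := k :* (w :* w) :+ (w :* (M :* s) :+ (k :* M :* w :+ con 2 :* k :* w :* (M :* (con 1 :+ w))))) refl w k s M ⟩
    k * (w * w) + rest ∎

count-ends : ∀ w {k} → 0 < k → (F : List (Subset (suc w))) → LocallyWide k F →
  count (Arcs.Family.ends w F) (suc w) + k < 2 * k * suc w
-- For `n = 1` no arc has between 1 and `n` - 1 elements, so the claim is `k < 2 * k`.
count-ends zero    {suc k} _ F _ = subst (suc k <_) (sym (*-identityʳ (2 * suc k))) (m<m+n (suc k) z<s)
count-ends w@(suc _) {k} 0<k F wide = average 0<k λ M →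
  subst (λ c → w * c + k * (M * suc w) ≤ w * (k * w) + 2 * k * w * (M * suc w)) (count-* ends-periodic M) (count-bound (M * suc w))
  where
  open Arcs.Family w F
  open Sweep w k z<s ends ends-sorted (λ x → All.tabulate (proj₁ ∘ ends⁻))
    (λ x → All.tabulate (proj₁ ∘ proj₂ ∘ ends⁻)) (Arcs.Family.wide⇒no-chain w F wide)

-- A single set is an antichain, so for `k = 0` no member contains a point.
wide-0 : ∀ {n} {F : List (Subset n)} → LocallyWide 0 F → ∀ {U} → U ∈ F → U ∈ ⊥ ∷ []
wide-0 wide {U} U∈ = here (⊆-antisym (λ {x} x∈U → contradiction
  (wide x (U ∷ []) ([] ∷ []) ((U∈ , x∈U) ∷ []) λ { (here refl) (here refl) _ → refl }) λ ()) ⊥⊆)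

theorem3p6p1 : ∀ (n : ℕ) .{{_ : NonZero n}} (k : ℕ) (F : List (Subset n)) →
    IsFamily F → All IsArc F → LocallyWide k F →
    length F ≤ 2 * k * n ∸ k + 1
theorem3p6p1 n zero F unique _ wide = unique-⊆⇒length≤ unique (wide-0 wide)
theorem3p6p1 n@(suc w) k@(suc _) F unique arcs wide = begin
  length F                   ≤⟨ length≤count unique arcs ⟩
  -- Of the two extra sets, the empty and the full one, one is paid for by the strictness of
  -- `count-ends`, the other by the final `+ 1`.
  2 + count ends n           ≡⟨ +-comm 1 (suc (count ends n)) ⟩
  suc (count ends n) + 1     ≤⟨ +-monoˡ-≤ 1 (m+n≤o⇒m≤o∸n (suc (count ends n)) (count-ends w z<s F wide)) ⟩
  2 * k * n ∸ k + 1          ∎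
  where
  open ≤-Reasoning
  open Arcs.Family w F
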